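{- Let $\mathcal L$ be a countable relational language with maximum arity $t\geq 2$, and let $M$ be an ultrahomogeneous $\mathcal L$-structure such that $\mathrm{Th}(M)$ has quantifier elimination. Suppose that for every $\bar a\in\mathrm{Age}(M)$ with $|\bar a|<t$, $M$ has the $\bar a$-Ramsey property for externally atomic-definable $2$-colourings. Then $M$ has the externally definable Ramsey property.
   Context: A structure $M$ is ultrahomogeneous if every isomorphism between finite substructures of $M$ extends to an automorphism of $M$. $\mathrm{Age}(M)$ is the class of finite structures embeddable in $M$. Writing $\bar a\in\mathrm{Age}(M)$ means a structure $A\in\mathrm{Age}(M)$ together with an enumeration $\bar a$ (without repetition) of its elements. For a structure $B$, $\binom{B}{\bar a}=\{f(\bar a): f:A\to B \text{ an embedding}\}$. A $k$-colouring of $\binom{M}{\bar a}$ is a function $\chi:\binom{M}{\bar a}\to k=\{0,\dots,k-1\}$. It is externally definable if there are an elementary extension $N\succeq M$, a finite tuple $\bar e$ in $N$ and formulae $\phi_0(\bar x,\bar y),\dots,\phi_{k-1}(\bar x,\bar y)$ (no parameters) such that for all $\bar a'\in\binom{M}{\bar a}$ and $i<k$: $\chi(\bar a')=i\iff N\models\phi_i(\bar e,\bar a')$. A $2$-colouring $\chi$ is externally atomic-definable if there are $N\succeq M$, $\bar e$ in $N$ and an atomic formula $\phi(\bar x,\bar y)$ (possibly an equality) such that $\chi(\bar a')=0\iff N\models\phi(\bar e,\bar a')$ for all $\bar a'\in\binom{M}{\bar a}$. For a set $\Gamma$ of colourings of $\binom{M}{\bar a}$, $M$ has the $\bar a$-Ramsey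 property for $\Gamma$ if for every $B\in\mathrm{Age}(M)$ and every $\chi\in\Gamma$ there is a substructure $B'\subseteq M$ with $B'\cong B$ such that $\chi$ is constant on $\binom{B'}{\bar a}$. $M$ has the externally definable Ramsey property if for all $\bar a\in\mathrm{Age}(M)$ and all $k\geq1$, $M$ has the $\bar a$-Ramsey property for the set of all externally definable $k$-colourings of $\binom{M}{\bar a}$. -}

module Defs where

open import Data.Empty.Polymorphic using (⊥)
open import Data.Fin.Base using (Fin; zero)
open import Data.Nat.Base using (ℕ; suc; _+_; _≤_)
open import Data.Product.Base using (Σ; Σ-syntax; ∃-syntax; _×_; _,_; proj₁; proj₂)
open import Data.Vec.Functional using (Vector; []; _∷_; _++_)
open import Function.Base using (_∘_)
open import Function.Bundles using (Injection; Bijection; Func; Equivalence; _⇔_; _↣_; mk⇔)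
open import Level using (Level) renaming (suc to lsuc)
open import Relation.Binary.Bundles using (Setoid)
open import Relation.Binary.Definitions using (_Respects_)
open import Relation.Binary.PropositionalEquality using (_≡_; setoid)
import Relation.Binary.Construct.On as On

record Language : Set₁ where
  field
    Symbol : Set
    arity  : Symbol → ℕ

-- Includes finite languages.
Countable : Language → Set
Countable L = Language.Symbol L ↣ ℕ

MaximumArity : Language → ℕ → Set
MaximumArity L t = (∀ R → arity R ≤ t) × (∃[ R ] arity R ≡ t)
  where open Language L

-- Structures have setoid domains, whose equality interprets the equality
-- symbol.
record Structure (L : Language) (ℓ : Level) : Set (lsuc ℓ) where
  open Language L
  field
    domain : Setoid ℓ ℓ
  open Setoid domain public
  field
    ⟦_⟧      : (R : Symbol) → Vector Carrier (arity R) → Set ℓ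
    ⟦⟧-resp : (R : Symbol) {v w : Vector Carrier (arity R)} →
               (∀ i → v i ≈ w i) → ⟦ R ⟧ v → ⟦ R ⟧ w

module _ {L : Language} {ℓ : Level} where
  open Language L
  open Structure using (domain; Carrier)

  record Embedding (A B : Structure L ℓ) : Set ℓ where
    private
      module A = Structure A
      module B = Structure B
    field
      injection : Injection A.domain B.domain
    open Injection injection public using (to; cong; injective)
    field
      relations : (R : Symbol) (v : Vector A.Carrier (arity R)) →
                  A.⟦ R ⟧ v ⇔ B.⟦ R ⟧ (to ∘ v)

  record Isomorphism (A B : Structure L ℓ) : Set ℓ where
    private
      module A = Structure A
      module B = Structure B
    field
      bijection : Bijection A.domain B.domain
    open Bijection bijection public using (to; cong; injective; surjective)
    field
      relations : (R : Symbol) (v : Vector A.Carrier (arity R)) →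
                  A.⟦ R ⟧ v ⇔ B.⟦ R ⟧ (to ∘ v)

  Automorphism : Structure L ℓ → Set ℓ
  Automorphism M = Isomorphism M M

  Enumeration : Structure L ℓ → ℕ → Set ℓ
  Enumeration A n = Bijection (setoid (Fin n)) (domain A)

  Finite : Structure L ℓ → Set ℓ
  Finite A = ∃[ n ] Enumeration A n

  -- There are no function symbols, so every subset carries a substructure.
  record Substructure (M : Structure L ℓ) : Set (lsuc ℓ) where
    open Structure M using (_≈_)
    field
      Member      : Carrier M → Set ℓ
      Member-resp : Member Respects _≈_

  induced : {M : Structure L ℓ} → Substructure M → Structure L ℓ
  induced {M} S = record
    { domain  = On.setoid {B = Σ (Carrier M) Member} (domain M) proj₁
    ; ⟦_⟧     = λ R v → ⟦ R ⟧ (proj₁ ∘ v)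
    ; ⟦⟧-resp = λ R → ⟦⟧-resp R
    }
    where
    open Structure M using (⟦_⟧; ⟦⟧-resp)
    open Substructure S

  inclusion : {M : Structure L ℓ} (S : Substructure M) → Embedding (induced S) M
  inclusion S = record
    { injection = record { to = proj₁ ; cong = λ p → p ; injective = λ p → p }
    ; relations = λ R v → mk⇔ (λ r → r) (λ r → r)
    }

  _∘ₑ_ : {A B C : Structure L ℓ} → Embedding B C → Embedding A B → Embedding A C
  g ∘ₑ f = record
    { injection = record
      { to        = G.to ∘ F.to
      ; cong      = λ p → G.cong (F.cong p)
      ; injective = λ p → F.injective (G.injective p)
      }
    ; relations = λ R v → mk⇔
        (λ r → Equivalence.to (G.relations R (F.to ∘ v))
                 (Equivalence.to (F.relations R v) r))
        (λ r → Equivalence.from (F.relations R v)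
                 (Equivalence.from (G.relations R (F.to ∘ v)) r))
    }
    where
    module F = Embedding f
    module G = Embedding g

  Ultrahomogeneous : Structure L ℓ → Set (lsuc ℓ)
  Ultrahomogeneous M =
    (S T : Substructure M) → Finite (induced S) → Finite (induced T) →
    (g : Isomorphism (induced S) (induced T)) →
    Σ[ σ ∈ Automorphism M ]
      (∀ s → Isomorphism.to σ (proj₁ s) ≈ proj₁ (Isomorphism.to g s))
    where open Structure M using (_≈_)

  _∈Age_ : Structure L ℓ → Structure L ℓ → Set ℓ
  A ∈Age M = Finite A × Embedding A M

  -- The pairs (A , ā) abbreviated "ā ∈ Age(M)".
  record EnumeratedAge (M : Structure L ℓ) : Set (lsuc ℓ) where
    field
      structure   : Structure L ℓ
      size        : ℕ
      enumeration : Enumeration structure size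
      embeds      : Embedding structure M

    tuple : Vector (Carrier structure) size
    tuple = Bijection.to enumeration

-- The free variables of a formula are indexed by Fin n; ∀′ binds index zero.
data Atomic (L : Language) (n : ℕ) : Set where
  _≐_ : Fin n → Fin n → Atomic L n
  rel : (R : Language.Symbol L) → Vector (Fin n) (Language.arity L R) → Atomic L n

-- ⊥, ⇒ and ∀ form a complete set of connectives and quantifiers for
-- classical logic.
data Formula (L : Language) : ℕ → Set where
  atom : ∀ {n} → Atomic L n → Formula L n
  ⊥′   : ∀ {n} → Formula L n
  _⇒_  : ∀ {n} → Formula L n → Formula L n → Formula L n
  ∀′   : ∀ {n} → Formula L (suc n) → Formula L n

data QuantifierFree {L : Language} {n : ℕ} : Formula L n → Set where
  atom : (α : Atomic L n) → QuantifierFree (atom α)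
  ⊥′   : QuantifierFree ⊥′
  _⇒_  : ∀ {φ ψ} → QuantifierFree φ → QuantifierFree ψ → QuantifierFree (φ ⇒ ψ)

Sentence : Language → Set
Sentence L = Formula L 0

Theory : Language → (ℓ : Level) → Set (lsuc ℓ)
Theory L ℓ = Sentence L → Set ℓ

module _ {L : Language} {ℓ : Level} where
  open Language L
  open Structure using (Carrier)

  module _ (M : Structure L ℓ) where
    open Structure M using (_≈_; ⟦_⟧)

    SatAtomic : ∀ {n} → Atomic L n → Vector (Carrier M) n → Set ℓ
    SatAtomic (i ≐ j)    v = v i ≈ v j
    SatAtomic (rel R is) v = ⟦ R ⟧ (v ∘ is)

    Sat : ∀ {n} → Formula L n → Vector (Carrier M) n → Set ℓ
    Sat (atom α) v = SatAtomic α v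
    Sat ⊥′       v = ⊥
    Sat (φ ⇒ ψ)  v = Sat φ v → Sat ψ v
    Sat (∀′ φ)   v = (x : Carrier M) → Sat φ (x ∷ v)

    Th : Theory L ℓ
    Th σ = Sat σ []

  _⊨_ : Structure L ℓ → Theory L ℓ → Set ℓ
  N ⊨ T = ∀ σ → T σ → Sat N σ []

  HasQuantifierElimination : Theory L ℓ → Set (lsuc ℓ)
  HasQuantifierElimination T =
    ∀ {n} (φ : Formula L n) →
    Σ[ ψ ∈ Formula L n ] QuantifierFree ψ ×
      ((N : Structure L ℓ) → N ⊨ T → ∀ v → Sat N φ v ⇔ Sat N ψ v)

  -- N ≽ M, with the inclusion of M in N given as an elementary embedding.
  record ElementaryExtension (M : Structure L ℓ) : Set (lsuc ℓ) where
    field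
      extension : Structure L ℓ
      embedding : Embedding M extension
    open Embedding embedding public using () renaming (to to ι)
    field
      elementary : ∀ {n} (φ : Formula L n) (v : Vector (Carrier M) n) →
                   Sat M φ v ⇔ Sat extension φ (ι ∘ v)

  module _ {M : Structure L ℓ} (a : EnumeratedAge M) where
    open EnumeratedAge a

    IsCopy : (B : Structure L ℓ) → Vector (Carrier B) size → Set ℓ
    IsCopy B b = Σ[ f ∈ Embedding structure B ] (∀ i → b i ≈ Embedding.to f (tuple i))
      where open Structure B using (_≈_)

    -- Copies are compared as tuples only, so that a colouring cannot depend
    -- on the witnessing embedding.
    Copies : Structure L ℓ → Setoid ℓ ℓ
    Copies B = record
      { Carrier       = Σ (Vector (Carrier B) size) (IsCopy B)
      ; _≈_           = λ c d → ∀ i → proj₁ c i ≈ proj₁ d i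
      ; isEquivalence = record
        { refl  = λ i → refl
        ; sym   = λ p i → sym (p i)
        ; trans = λ p q i → trans (p i) (q i)
        }
      }
      where open Structure B using (_≈_; refl; sym; trans)

    Copy : Structure L ℓ → Set ℓ
    Copy B = Setoid.Carrier (Copies B)

    includeCopy : (S : Substructure M) → Copy (induced S) → Copy M
    includeCopy S (b , f , b≈fa) = proj₁ ∘ b , (inclusion S ∘ₑ f) , b≈fa

    Colouring : ℕ → Set ℓ
    Colouring k = Func (Copies M) (setoid (Fin k))

    ConstantOn : ∀ {k} → Colouring k → Substructure M → Set ℓ
    ConstantOn χ S = (c d : Copy (induced S)) →
                     Func.to χ (includeCopy S c) ≡ Func.to χ (includeCopy S d)

    -- The variables x̄ (for the parameters e) come first, followed by ȳ.
    ExternallyDefinable : ∀ {k} → Colouring k → Set (lsuc ℓ)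
    ExternallyDefinable {k} χ =
      Σ[ E ∈ ElementaryExtension M ] let open ElementaryExtension E in
      Σ[ m ∈ ℕ ] Σ[ e ∈ Vector (Carrier extension) m ]
      Σ[ φ ∈ (Fin k → Formula L (m + size)) ]
        (∀ (c : Copy M) (i : Fin k) →
          Func.to χ c ≡ i ⇔ Sat extension (φ i) (e ++ (ι ∘ proj₁ c)))

    ExternallyAtomicDefinable : Colouring 2 → Set (lsuc ℓ)
    ExternallyAtomicDefinable χ =
      Σ[ E ∈ ElementaryExtension M ] let open ElementaryExtension E in
      Σ[ m ∈ ℕ ] Σ[ e ∈ Vector (Carrier extension) m ]
      Σ[ α ∈ Atomic L (m + size) ]
        (∀ (c : Copy M) →
          Func.to χ c ≡ zero ⇔ Sat extension (atom α) (e ++ (ι ∘ proj₁ c)))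

    RamseyProperty : ∀ {k} → (Colouring k → Set (lsuc ℓ)) → Set (lsuc ℓ)
    RamseyProperty {k} Γ =
      (B : Structure L ℓ) → B ∈Age M → (χ : Colouring k) → Γ χ →
      Σ[ S ∈ Substructure M ] Isomorphism (induced S) B × ConstantOn χ S

  ExternallyDefinableRamsey : Structure L ℓ → Set (lsuc ℓ)
  ExternallyDefinableRamsey M =
    (a : EnumeratedAge M) (k : ℕ) → 1 ≤ k →
    RamseyProperty a {k} (ExternallyDefinable a)

{-# OPTIONS --safe #-}
-- Quantifier elimination reduces an externally definable colouring to finitely
-- many atomic formulas α(e , ȳ), on each of which a copy of B has to be
-- homogeneous.  If α mentions a parameter from e, then it mentions fewer than t
-- of the variables ȳ, so the hypothesis provides such a copy for α alone; if it
-- mentions none, then it is constant on copies because embeddings preserve it.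
--
-- Several atoms are treated one after the other by compactness.  For every
-- finite tuple v in M, ultrahomogeneity gives an automorphism σ_v moving v into
-- a set on which the first atom is homogeneous.  In the ultrapower of N over
-- the finite tuples, with M embedded by x ↦ [ι (σ_v x)]_v and e constant, the
-- first atom is homogeneous on all of M.  A copy of B on which the remaining
-- atoms are homogeneous there is finite, so by Łoś's theorem its image under
-- some σ_v is homogeneous in N for all the atoms at once.
--
-- Excluded middle for arbitrary types is a global choice principle, which
-- yields the ultrafilter.
module Submission where

open import Defs
open import Axiom.ExcludedMiddle using (ExcludedMiddle)
open import Axiom.Extensionality.Propositional using (Extensionality)
open import Data.Bool.Base using (Bool; true; false; T)
open import Data.Empty using (⊥; ⊥-elim)
open import Data.Fin.Base using (Fin; zero; suc; _↑ˡ_; _↑ʳ_; splitAt; join; finToFun; funToFin)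
open import Data.Fin.Properties using (splitAt-join; join-splitAt; finToFun-funToFin)
open import Data.List.Base using (List; []; _∷_; tabulate; concat) renaming (_++_ to _++ˡ_)
open import Data.List.Relation.Unary.All using (All; []; _∷_)
import Data.List.Relation.Unary.All as All
import Data.List.Relation.Unary.All.Properties as All
open import Data.Nat.Base using (ℕ; zero; suc; _+_; _≤_; _<_; z≤n; s≤s)
open import Data.Nat.Properties using (≤-trans; m≤n⇒m≤1+n)
open import Data.Product.Base using (Σ; Σ-syntax; ∃; _×_; _,_; proj₁; proj₂)
open import Data.Sum.Base using (_⊎_; inj₁; inj₂; [_,_]′; map₂)
open import Data.Sum.Relation.Binary.Pointwise using (Pointwise; inj₁; inj₂; Pointwise-≡⇒≡)
open import Data.Unit.Base using (tt)
open import Data.Vec.Functional using (Vector; _++_) renaming ([] to []ᵥ; _∷_ to _∷ᵥ_)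
open import Data.Vec.Functional.Properties using (lookup-++ˡ; lookup-++ʳ)
import Data.Vec.Functional.Relation.Binary.Pointwise.Properties as Pointwiseᵥ
open import Function.Base using (_∘_; id)
open import Function.Bundles using (Bijection; Func; Equivalence; _⇔_; mk⇔)
open import Function.Construct.Composition using (_⇔-∘_)
import Function.Construct.Composition as Composition
open import Function.Construct.Identity using (⇔-id)
open import Function.Construct.Symmetry using (⇔-sym)
import Function.Construct.Symmetry as Symmetry
open import Function.Properties.Surjection using (injective⇒to⁻-cong)
open import Level using (Level; Lift; lift; lower; _⊔_)
import Relation.Binary.Construct.On as On
open import Relation.Binary.Bundles using (Setoid)
open import Relation.Binary.PropositionalEquality using (_≡_; refl; sym; trans; cong; subst; setoid)
open import Relation.Nullary using (¬_; Dec; yes; no)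
open import Relation.Nullary.Decidable using (⌊_⌋; toWitness; fromWitness; decidable-stable)

-- Removing repetitions from finite tuples.

module _ {c ℓ z} (X : Setoid c ℓ) {Z : Set z} where
  open Setoid X using (_≈_) renaming (Carrier to ∣X∣; refl to ≈-refl; sym to ≈-sym)

  -- `Z` holds entries that are passed through untouched: the parameter variables in `factor-tuple`,
  -- none at all in `homogenise`.
  record Deduplication {r} (v : Fin r → Z ⊎ ∣X∣) : Set (c ⊔ ℓ ⊔ z) where
    field
      {size}    : ℕ
      entries   : Vector ∣X∣ size
      injective : ∀ {i j} → entries i ≈ entries j → i ≡ j
      indices   : Fin r → Z ⊎ Fin size
      factors   : ∀ k → Pointwise _≡_ _≈_ (v k) (map₂ entries (indices k))
      size≤     : size ≤ r
      -- An entry in Z is not listed in entries, which leaves room below r.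
      size<     : (∀ k → ∃ λ j → indices k ≡ inj₂ j) ⊎ size < r

  deduplicate : (∀ x {n} (w : Vector ∣X∣ n) → Dec (∃ λ j → x ≈ w j)) →
    ∀ {r} (v : Fin r → Z ⊎ ∣X∣) → Deduplication v
  deduplicate _∈?_ {zero} v = record
    { entries   = []ᵥ
    ; injective = λ { {()} }
    ; indices   = λ ()
    ; factors   = λ ()
    ; size≤     = z≤n
    ; size<     = inj₁ λ ()
    }
  deduplicate _∈?_ {suc r} v with deduplicate _∈?_ (v ∘ suc)
  ... | rest with v zero in v₀
  ...   | inj₁ y = record
    { entries   = entries
    ; injective = injective
    ; indices   = inj₁ y ∷ᵥ indices
    ; factors   = λ { zero → subst (λ u → Pointwise _≡_ _≈_ u _) (sym v₀) (inj₁ refl) ; (suc k) → factors k }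
    ; size≤     = m≤n⇒m≤1+n size≤
    ; size<     = inj₂ (s≤s size≤)
    }
    where open Deduplication rest
  ...   | inj₂ x with x ∈? Deduplication.entries rest
  ...     | yes (j , x≈) = record
    { entries   = entries
    ; injective = injective
    ; indices   = inj₂ j ∷ᵥ indices
    ; factors   = λ { zero → subst (λ u → Pointwise _≡_ _≈_ u _) (sym v₀) (inj₂ x≈) ; (suc k) → factors k }
    ; size≤     = m≤n⇒m≤1+n size≤
    -- A repetition leaves room below the length too, even if no entry lies in `Z`.
    ; size<     = inj₂ (s≤s size≤)
    }
    where open Deduplication rest
  ...     | no x∉ = record
    { entries   = x ∷ᵥ entries
    ; injective = λ {i} {j} → injective′ i j
    ; indices   = inj₂ zero ∷ᵥ (map₂ suc ∘ indices)
    ; factors   = λ { zero → subst (λ u → Pointwise _≡_ _≈_ u _) (sym v₀) (inj₂ ≈-refl)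
                    ; (suc k) → shift (indices k) (factors k) }
    ; size≤     = s≤s size≤
    ; size<     = size<-suc size<
    }
    where
    open Deduplication rest
    injective′ : ∀ i j → (x ∷ᵥ entries) i ≈ (x ∷ᵥ entries) j → i ≡ j
    injective′ zero    zero    _  = refl
    injective′ zero    (suc j) eq = ⊥-elim (x∉ (j , eq))
    injective′ (suc i) zero    eq = ⊥-elim (x∉ (i , ≈-sym eq))
    injective′ (suc i) (suc j) eq = cong suc (injective eq)
    shift : ∀ {y} u → Pointwise _≡_ _≈_ y (map₂ entries u) →
      Pointwise _≡_ _≈_ y (map₂ (x ∷ᵥ entries) (map₂ suc u))
    shift (inj₁ _) p = p
    shift (inj₂ _) p = p
    size<-suc : (∀ k → ∃ λ j → indices k ≡ inj₂ j) ⊎ size < r →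
      (∀ k → ∃ λ j → (inj₂ zero ∷ᵥ (map₂ suc ∘ indices)) k ≡ inj₂ j) ⊎ suc size < suc r
    size<-suc (inj₁ all) = inj₁ λ
      { zero → zero , refl
      ; (suc k) → let j , eq = all k in suc j , cong (map₂ suc) eq }
    size<-suc (inj₂ lt) = inj₂ (s≤s lt)

-- Renaming of variables in atomic formulas.

under : ∀ m {n s} → (Fin n → Fin s) → Fin (m + n) → Fin (m + s)
under m {n} {s} h = join m s ∘ map₂ h ∘ splitAt m

++-under : ∀ {a} {A : Set a} {m n s} (xs : Vector A m) (ys : Vector A s) (h : Fin n → Fin s) k →
  (xs ++ ys) (under m h k) ≡ (xs ++ (ys ∘ h)) k
++-under {m = m} {s = s} xs ys h k
  rewrite splitAt-join m s (map₂ h (splitAt m k)) with splitAt m k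
... | inj₁ _ = refl
... | inj₂ _ = refl

module _ {L : Language} where

  rename : ∀ {m n} → (Fin m → Fin n) → Atomic L m → Atomic L n
  rename ρ (i ≐ j)    = ρ i ≐ ρ j
  rename ρ (rel R is) = rel R (ρ ∘ is)

  Sat-rename : ∀ {ℓ m n} {N : Structure L ℓ} (ρ : Fin m → Fin n) (α : Atomic L m) {v} →
    SatAtomic N (rename ρ α) v ⇔ SatAtomic N α (v ∘ ρ)
  Sat-rename ρ (i ≐ j)    = ⇔-id _
  Sat-rename ρ (rel R is) = ⇔-id _

-- Embeddings, isomorphisms and satisfaction.

module _ {L : Language} {ℓ : Level} where
  open Structure using (Carrier; domain)

  idₑ : {A : Structure L ℓ} → Embedding A A
  idₑ = record
    { injection = record { to = id ; cong = id ; injective = id }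
    ; relations = λ R v → ⇔-id _
    }

  isoEmbedding : {A B : Structure L ℓ} → Isomorphism A B → Embedding A B
  isoEmbedding g = record { injection = Bijection.injection bijection ; relations = relations }
    where open Isomorphism g

  infixr 9 _∘ᵢ_
  _∘ᵢ_ : {A B C : Structure L ℓ} → Isomorphism B C → Isomorphism A B → Isomorphism A C
  g ∘ᵢ f = record
    { bijection = Composition.bijection F.bijection G.bijection
    ; relations = λ R v → G.relations R (F.to ∘ v) ⇔-∘ F.relations R v
    }
    where
    module F = Isomorphism f
    module G = Isomorphism g

  module _ {A B : Structure L ℓ} (f : Isomorphism A B) where
    private
      module B = Structure B
      module F = Isomorphism f

    from : Carrier B → Carrier A
    from = Bijection.to⁻ F.bijection

    to-from : ∀ y → F.to (from y) B.≈ y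
    to-from y = proj₂ (Bijection.strictlySurjective F.bijection y)

    infix 10 _⁻¹
    _⁻¹ : Isomorphism B A
    _⁻¹ = record
      { bijection = Symmetry.bijection F.bijection
          (injective⇒to⁻-cong (Bijection.surjection F.bijection) F.injective)
      ; relations = λ R v →
          ⇔-sym (F.relations R (from ∘ v)) ⇔-∘
          mk⇔ (B.⟦⟧-resp R (B.sym ∘ to-from ∘ v)) (B.⟦⟧-resp R (to-from ∘ v))
      }

    Finite-iso : Finite A → Finite B
    Finite-iso (n , enumeration) = n , Composition.bijection enumeration F.bijection

    preimage : Substructure B → Substructure A
    preimage S = record
      { Member      = Member ∘ F.to
      ; Member-resp = Member-resp ∘ F.cong
      }
      where open Substructure S

    preimage-iso : ∀ S → Isomorphism (induced (preimage S)) (induced S)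
    preimage-iso S = record
      { bijection = record
        { to        = λ (x , x∈) → F.to x , x∈
        ; cong      = F.cong
        ; bijective = F.injective , λ (y , y∈) →
            (from y , Member-resp (B.sym (to-from y)) y∈) ,
            λ z≈ → B.trans (F.cong z≈) (to-from y)
        }
      ; relations = λ R v → F.relations R (proj₁ ∘ v)
      }
      where open Substructure S

  module _ {B M : Structure L ℓ} (f : Embedding B M) where
    private
      module M = Structure M
      module F = Embedding f

    image : Substructure M
    image = record
      { Member      = λ x → Σ[ b ∈ Carrier B ] F.to b M.≈ x
      ; Member-resp = λ x≈y (b , fb≈x) → b , M.trans fb≈x x≈y
      }

    image-iso : Isomorphism B (induced image)
    image-iso = record
      { bijection = record
        { to        = λ b → F.to b , b , M.refl
        ; cong      = F.cong
        ; bijective = F.injective , λ (_ , b , fb≈x) → b , λ z≈b → M.trans (F.cong z≈b) fb≈x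
        }
      ; relations = F.relations
      }

  pullback : (A : Structure L ℓ) {X : Set ℓ} → (X → Carrier A) → Structure L ℓ
  pullback A g = record
    { domain  = On.setoid (domain A) g
    ; ⟦_⟧     = λ R v → ⟦ R ⟧ (g ∘ v)
    ; ⟦⟧-resp = λ R → ⟦⟧-resp R
    }
    where open Structure A using (⟦_⟧; ⟦⟧-resp)

  pullback-embedding : (A : Structure L ℓ) {X : Set ℓ} (g : X → Carrier A) → Embedding (pullback A g) A
  pullback-embedding A g = record
    { injection = record { to = g ; cong = id ; injective = id }
    ; relations = λ R v → ⇔-id _
    }

  module _ (A : Structure L ℓ) {n : ℕ} (w : Vector (Carrier A) n)
    (w-injective : ∀ {i j} → Structure._≈_ A (w i) (w j) → i ≡ j) where

    spanned : Structure L ℓ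
    spanned = pullback A {Lift ℓ (Fin n)} (w ∘ lower)

    spanned-enumeration : Enumeration spanned n
    spanned-enumeration = record
      { to        = lift
      ; cong      = λ { refl → Structure.refl A }
      ; bijective = w-injective , λ (lift i) → i , λ { refl → Structure.refl A }
      }

    spanned-embedding : Embedding spanned A
    spanned-embedding = pullback-embedding A (w ∘ lower)

  -- Injectivity reflects equality atoms. Allowing any `w` equal to the image of `v` absorbs the
  -- setoid equality and yields `SatAtomic-resp` from the identity.
  SatAtomic-embedding : {A B : Structure L ℓ} (f : Embedding A B) → let open Structure B using (_≈_) in
    ∀ {n} (α : Atomic L n) {v w} → (∀ k → Embedding.to f (v k) ≈ w k) →
    SatAtomic A α v ⇔ SatAtomic B α w
  SatAtomic-embedding {A} {B} f (i ≐ j) fv≈w = mk⇔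
    (λ vi≈vj → B.trans (B.sym (fv≈w i)) (B.trans (F.cong vi≈vj) (fv≈w j)))
    (λ wi≈wj → F.injective (B.trans (fv≈w i) (B.trans wi≈wj (B.sym (fv≈w j)))))
    where
    module B = Structure B
    module F = Embedding f
  SatAtomic-embedding {A} {B} f (rel R is) {v} fv≈w =
    mk⇔ (B.⟦⟧-resp R (fv≈w ∘ is)) (B.⟦⟧-resp R (B.sym ∘ fv≈w ∘ is)) ⇔-∘
    Embedding.relations f R (v ∘ is)
    where module B = Structure B

  SatAtomic-resp : (A : Structure L ℓ) → let open Structure A using (_≈_) in
    ∀ {n} (α : Atomic L n) {v w} → (∀ k → v k ≈ w k) → SatAtomic A α v → SatAtomic A α w
  SatAtomic-resp A α v≈w = Equivalence.to (SatAtomic-embedding (idₑ {A}) α v≈w)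

  Sat-iso : {A B : Structure L ℓ} (f : Isomorphism A B) → let open Structure B using (_≈_) in
    ∀ {n} (φ : Formula L n) {v w} → (∀ k → Isomorphism.to f (v k) ≈ w k) →
    Sat A φ v ⇔ Sat B φ w
  Sat-iso f (atom α) fv≈w = SatAtomic-embedding (isoEmbedding f) α fv≈w
  Sat-iso f ⊥′       fv≈w = mk⇔ (λ ()) (λ ())
  Sat-iso f (φ ⇒ ψ)  fv≈w = mk⇔
    (λ s → Equivalence.to (Sat-iso f ψ fv≈w) ∘ s ∘ Equivalence.from (Sat-iso f φ fv≈w))
    (λ s → Equivalence.from (Sat-iso f ψ fv≈w) ∘ s ∘ Equivalence.to (Sat-iso f φ fv≈w))
  Sat-iso {A} {B} f (∀′ φ) {v} {w} fv≈w = mk⇔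
    (λ s y → Equivalence.to (Sat-iso f φ (extend (to-from f y))) (s (from f y)))
    (λ s x → Equivalence.from (Sat-iso f φ (extend (Structure.refl B))) (s (Isomorphism.to f x)))
    where
    extend : ∀ {x y} → Structure._≈_ B (Isomorphism.to f x) y →
      ∀ k → Structure._≈_ B (Isomorphism.to f ((x ∷ᵥ v) k)) ((y ∷ᵥ w) k)
    extend fx≈y zero    = fx≈y
    extend fx≈y (suc k) = fv≈w k

  -- Copies of an enumerated structure and of its subtuples.

  module _ {M : Structure L ℓ} (a : EnumeratedAge M) where
    open EnumeratedAge a
    private module M = Structure M

    IsCopy-∘ : {N P : Structure L ℓ} (g : Embedding N P) {c : Vector (Carrier N) size} →
      IsCopy a N c → IsCopy a P (Embedding.to g ∘ c)
    IsCopy-∘ g (f , c≈f) = (g ∘ₑ f) , Embedding.cong g ∘ c≈f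

    restrictCopy : (S : Substructure M) → ((c , _) : Copy a M) → (∀ k → Substructure.Member S (c k)) →
      Copy a (induced S)
    restrictCopy S (c , f , c≈f) c∈S = (λ k → c k , c∈S k) , record
      { injection = record
        { to = λ x → F.to x , f∈S x ; cong = F.cong ; injective = F.injective }
      ; relations = F.relations
      } , c≈f
      where
      module F = Embedding f
      open Substructure S
      -- Every element of the finite structure occurs in `tuple`, so the entries of `c` already
      -- exhaust the image of `f`.
      f∈S : ∀ x → Member (F.to x)
      f∈S x = let k , k≈x = Bijection.strictlySurjective enumeration x in
        Member-resp (M.trans (c≈f k) (F.cong k≈x)) (c∈S k)

    module _ {n : ℕ} (h : Fin n → Fin size) (h-injective : ∀ {i j} → h i ≡ h j → i ≡ j) where

      private
        subtuple-injective : ∀ {i j} → Structure._≈_ structure (tuple (h i)) (tuple (h j)) → i ≡ j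
        subtuple-injective = h-injective ∘ Bijection.injective enumeration

      -- With `h` listing the variables ȳ that occur in an atom, this is the smaller enumerated
      -- structure to which the Ramsey hypothesis is applied.
      subtuple : EnumeratedAge M
      subtuple = record
        { structure   = spanned structure (tuple ∘ h) subtuple-injective
        ; size        = n
        ; enumeration = spanned-enumeration structure (tuple ∘ h) subtuple-injective
        ; embeds      = embeds ∘ₑ spanned-embedding structure (tuple ∘ h) subtuple-injective
        }

      IsCopy-subtuple : ∀ {c} → IsCopy a M c → IsCopy subtuple M (c ∘ h)
      IsCopy-subtuple (f , c≈f) =
        (f ∘ₑ spanned-embedding structure (tuple ∘ h) subtuple-injective) , c≈f ∘ h

-- Quantifier-free formulas and colourings by truth value.

atoms : ∀ {L : Language} {n} {φ : Formula L n} → QuantifierFree φ → List (Atomic L n)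
atoms (atom α) = α ∷ []
atoms ⊥′       = []
atoms (p ⇒ q)  = atoms p ++ˡ atoms q

Sat-atoms : ∀ {L : Language} {ℓ n} {N : Structure L ℓ} {φ : Formula L n} (q : QuantifierFree φ) {v w} →
  All (λ α → SatAtomic N α v ⇔ SatAtomic N α w) (atoms q) → Sat N φ v ⇔ Sat N φ w
Sat-atoms (atom α) (v⇔w ∷ []) = v⇔w
Sat-atoms ⊥′       []         = mk⇔ id id
Sat-atoms (p ⇒ q)  v⇔w        = mk⇔
  (λ s → Equivalence.to Q ∘ s ∘ Equivalence.from P)
  (λ s → Equivalence.from Q ∘ s ∘ Equivalence.to P)
  where
  P = Sat-atoms p (All.++⁻ˡ (atoms p) v⇔w)
  Q = Sat-atoms q (All.++⁻ʳ (atoms p) v⇔w)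

colour : ∀ {p} {P : Set p} → Dec P → Fin 2
colour (yes _) = zero
colour (no _)  = suc zero

colour≡zero : ∀ {p} {P : Set p} (d : Dec P) → colour d ≡ zero ⇔ P
colour≡zero (yes p) = mk⇔ (λ _ → p) (λ _ → refl)
colour≡zero (no ¬p) = mk⇔ (λ ()) (λ p → ⊥-elim (¬p p))

colour-cong : ∀ {p q} {P : Set p} {Q : Set q} → (P → Q) → (Q → P) → (d : Dec P) (d′ : Dec Q) →
  colour d ≡ colour d′
colour-cong f g (yes p) (yes q) = refl
colour-cong f g (yes p) (no ¬q) = ⊥-elim (¬q (f p))
colour-cong f g (no ¬p) (yes q) = ⊥-elim (¬p (g q))
colour-cong f g (no ¬p) (no ¬q) = refl

-- Homogeneous sets for atomic formulas.

module _ {L : Language} {ℓ : Level} {M : Structure L ℓ} (a : EnumeratedAge M) where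
  open EnumeratedAge a
  open Structure M using (Carrier; _≈_)
  private module M = Structure M

  module _ (E : ElementaryExtension M) where
    open ElementaryExtension E
    private module N = Structure extension

    SatCopy : ∀ {m} → Vector N.Carrier m → Atomic L (m + size) → Vector Carrier size → Set ℓ
    SatCopy e α c = SatAtomic extension α (e ++ (ι ∘ c))

    SatCopy-resp : ∀ {m} (e : Vector N.Carrier m) α {c d} → (∀ k → c k ≈ d k) → SatCopy e α c → SatCopy e α d
    SatCopy-resp {m} e α {c} {d} c≈d = SatAtomic-resp extension α
      (Pointwiseᵥ.++⁺ N._≈_ {xs = e} {ys = e} {xs′ = ι ∘ c} {ys′ = ι ∘ d}
        (λ _ → N.refl) (Embedding.cong embedding ∘ c≈d))

    -- One implication suffices because `c` and `d` may be exchanged. A bare predicate `P` covers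
    -- the entries of a moved finite tuple as well as a substructure.
    Homogeneous : ∀ {m} → Vector N.Carrier m → Atomic L (m + size) → (Carrier → Set ℓ) → Set ℓ
    Homogeneous e α P = ∀ {c d} → IsCopy a M c → IsCopy a M d →
      (∀ k → P (c k)) → (∀ k → P (d k)) → SatCopy e α c → SatCopy e α d

  HomogeneousCopies : (E : ElementaryExtension M) → let open ElementaryExtension E in
    ∀ {m} → Vector (Structure.Carrier extension) m → List (Atomic L (m + size)) → Set (Level.suc ℓ)
  HomogeneousCopies E e αs = ∀ {B} → B ∈Age M →
    Σ[ S ∈ Substructure M ] Isomorphism (induced S) B ×
      All (λ α → Homogeneous E e α (Substructure.Member S)) αs

-- `Large` stays in the universe of `I`, which keeps an ultrapower in the universe of its factor. By
-- `cone`, whatever holds from some index upwards is large.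
record Ultrafilter {i} (I : Set i) (_≤_ : I → I → Set i) : Set (Level.suc i) where
  field
    Large     : (I → Set i) → Set i
    mono      : ∀ {P Q : I → Set i} → (∀ j → P j → Q j) → Large P → Large Q
    _∩_       : ∀ {P Q : I → Set i} → Large P → Large Q → Large (λ j → P j × Q j)
    decides   : ∀ {P : I → Set i} → ¬ Large P → Large (λ j → ¬ P j)
    inhabited : ∀ {P : I → Set i} → Large P → Σ I P
    cone      : ∀ j → Large (j ≤_)

  mono₂ : ∀ {P Q R : I → Set i} → (∀ j → P j → Q j → R j) → Large P → Large Q → Large R
  mono₂ f p q = mono (λ j (x , y) → f j x y) (p ∩ q)

-- Subsets under excluded middle.

module Classical (em : ∀ {a} → ExcludedMiddle a) (ext : ∀ {a b} → Extensionality a b) where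

  decide : ∀ {p} (P : Set p) → Dec P
  decide P = em

  by-contradiction : ∀ {p} {P : Set p} → ¬ ¬ P → P
  by-contradiction = decidable-stable em

  ¬∀⇒∃¬ : ∀ {a b} {A : Set a} {B : A → Set b} → ¬ (∀ x → B x) → Σ[ x ∈ A ] ¬ B x
  ¬∀⇒∃¬ ¬∀ = by-contradiction λ ¬∃ → ¬∀ λ x → by-contradiction λ ¬Bx → ¬∃ (x , ¬Bx)

  -- With values in Bool, the subsets of W live in the universe of W, and
  -- excluded middle gives comprehension for predicates of any level.
  Subset : ∀ {w} → Set w → Set w
  Subset W = W → Bool

  module _ {w} {W : Set w} where

    infix 4 _∈_ _⊆_

    _∈_ : W → Subset W → Set
    x ∈ S = T (S x)

    _⊆_ : Subset W → Subset W → Set w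
    S ⊆ S′ = ∀ {x} → x ∈ S → x ∈ S′

    ⟪_⟫ : ∀ {p} → (W → Set p) → Subset W
    ⟪ P ⟫ x = ⌊ decide (P x) ⌋

    ⊆-antisym : ∀ {S S′} → S ⊆ S′ → S′ ⊆ S → S ≡ S′
    ⊆-antisym {S} {S′} p q = ext λ x → Bool-antisym (S x) (S′ x) p q
      where
      Bool-antisym : ∀ a b → (T a → T b) → (T b → T a) → a ≡ b
      Bool-antisym false false _ _ = refl
      Bool-antisym false true  _ g = ⊥-elim (g tt)
      Bool-antisym true  false f _ = ⊥-elim (f tt)
      Bool-antisym true  true  _ _ = refl

    insert : W → Subset W → Subset W
    insert y S = ⟪ (λ x → x ∈ S ⊎ x ≡ y) ⟫

    ⋃ : Subset (Subset W) → Subset W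
    ⋃ C = ⟪ (λ x → Σ[ S ∈ Subset W ] T (C S) × x ∈ S) ⟫

  module _ {w} {W : Set w} where

    ∈insert⁺ˡ : ∀ {y} {S : Subset W} → S ⊆ insert y S
    ∈insert⁺ˡ p = fromWitness (inj₁ p)

    ∈insert⁺ʳ : ∀ {y} {S : Subset W} → y ∈ insert y S
    ∈insert⁺ʳ = fromWitness (inj₂ refl)

    ∈insert⁻ : ∀ {y} {S : Subset W} {x} → x ∈ insert y S → x ∈ S ⊎ x ≡ y
    ∈insert⁻ = toWitness

    ∈⋃⁺ : ∀ {C : Subset (Subset W)} {S} → S ∈ C → S ⊆ ⋃ C
    ∈⋃⁺ {S = S} p q = fromWitness (S , p , q)

    ∈⋃⁻ : ∀ {C : Subset (Subset W)} {x} → x ∈ ⋃ C → Σ[ S ∈ Subset W ] S ∈ C × x ∈ S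
    ∈⋃⁻ = toWitness

  -- Maximal sets by the Bourbaki-Witt tower.

  Chain : ∀ {w} {W : Set w} → Subset (Subset W) → Set w
  Chain C = ∀ {S S′} → S ∈ C → S′ ∈ C → S ⊆ S′ ⊎ S′ ⊆ S

  -- The Bourbaki–Witt tower: closing under a choice of a one-point good
  -- extension and under unions gives a chain, whose union is maximal.
  module Maximal {w g} {W : Set w} (Good : Subset W → Set g)
    (good-⋃ : ∀ C → Chain C → (∀ {S} → S ∈ C → Good S) → Good (⋃ C)) where

    Extendable : Subset W → Set (w ⊔ g)
    Extendable S = Σ[ y ∈ W ] ¬ (y ∈ S) × Good (insert y S)

    next : Subset W → Subset W
    next S with decide (Extendable S)
    ... | yes (y , _) = insert y S
    ... | no _        = S

    next-increasing : ∀ S → S ⊆ next S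
    next-increasing S p with decide (Extendable S)
    ... | yes _ = ∈insert⁺ˡ {S = S} p
    ... | no _  = p

    next-good : ∀ S → Good S → Good (next S)
    next-good S good with decide (Extendable S)
    ... | yes (_ , _ , good′) = good′
    ... | no _                = good

    -- `next S` has at most one point more than `S`, and everything depends on whether `S′` contains
    -- that point.
    next-minimal : ∀ S S′ → S ⊆ S′ → S′ ⊆ next S → S′ ⊆ S ⊎ next S ⊆ S′
    next-minimal S S′ S⊆S′ S′⊆ with decide (Extendable S)
    ... | no _ = inj₁ S′⊆
    ... | yes (y , _) with decide (y ∈ S′)
    ...   | yes y∈S′ = inj₂ λ p → [ S⊆S′ , (λ { refl → y∈S′ }) ]′ (∈insert⁻ {S = S} p)
    ...   | no  y∉S′ = inj₁ λ p → [ id , (λ { refl → ⊥-elim (y∉S′ p) }) ]′ (∈insert⁻ {S = S} (S′⊆ p))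

    next-maximal : ∀ S → next S ⊆ S → ∀ y → Good (insert y S) → y ∈ S
    next-maximal S next⊆ y good with decide (Extendable S)
    ... | yes (z , z∉S , _) = ⊥-elim (z∉S (next⊆ (∈insert⁺ʳ {S = S})))
    ... | no  ¬extendable   = by-contradiction λ y∉S → ¬extendable (y , y∉S , good)

    -- The empty set enters as the union of the empty family.
    data Tower : Subset W → Set w where
      step  : ∀ {S} → Tower S → Tower (next S)
      union : (C : Subset (Subset W)) → (∀ S → S ∈ C → Tower S) → Tower (⋃ C)

    Comparable : Subset W → Set w
    Comparable S = ∀ {S′} → Tower S′ → S′ ⊆ S ⊎ S ⊆ S′

    -- Induction on the second tower set. For a union, either some member already lies above
    -- `next S`, or all members lie below `S`.
    next-comparable : ∀ {S} → Comparable S → ∀ {S′} → Tower S′ → S′ ⊆ S ⊎ next S ⊆ S′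
    next-comparable {S} cmp (step {S′} t) with next-comparable cmp t
    ... | inj₂ nextS⊆S′ = inj₂ (λ p → next-increasing S′ (nextS⊆S′ p))
    ... | inj₁ S′⊆S with cmp (step t)
    ...   | inj₁ nextS′⊆S = inj₁ nextS′⊆S
    ...   | inj₂ S⊆nextS′ with next-minimal S′ S S′⊆S S⊆nextS′
    ...     | inj₂ nextS′⊆S = inj₁ nextS′⊆S
    -- `next` rests on a choice made by `decide`, so its values are compared by first making the two
    -- sets equal through extensionality.
    ...     | inj₁ S⊆S′ = inj₂ (subst (λ R → next S ⊆ next R) (⊆-antisym S⊆S′ S′⊆S) id)
    next-comparable {S} cmp (union C ts) with decide (Σ[ S′ ∈ Subset W ] S′ ∈ C × next S ⊆ S′)
    ... | yes (_ , S′∈C , nextS⊆S′) = inj₂ (λ p → ∈⋃⁺ {C = C} S′∈C (nextS⊆S′ p))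
    ... | no none = inj₁ λ p → below (∈⋃⁻ {C = C} p)
      where
      below : ∀ {x} → Σ[ S′ ∈ Subset W ] S′ ∈ C × x ∈ S′ → x ∈ S
      below (S′ , S′∈C , x∈S′) with next-comparable cmp (ts S′ S′∈C)
      ... | inj₁ S′⊆S     = S′⊆S x∈S′
      ... | inj₂ nextS⊆S′ = ⊥-elim (none (S′ , S′∈C , nextS⊆S′))

    tower-comparable : ∀ {S} → Tower S → Comparable S
    tower-comparable (step {S} t) t′ with next-comparable (tower-comparable t) t′
    ... | inj₁ S′⊆S     = inj₁ (λ p → next-increasing S (S′⊆S p))
    ... | inj₂ nextS⊆S′ = inj₂ nextS⊆S′
    tower-comparable (union C ts) {S′} t′ with decide (Σ[ S ∈ Subset W ] S ∈ C × S′ ⊆ S)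
    ... | yes (_ , S∈C , S′⊆S) = inj₁ (λ p → ∈⋃⁺ {C = C} S∈C (S′⊆S p))
    ... | no none = inj₂ λ p → above (∈⋃⁻ {C = C} p)
      where
      above : ∀ {x} → Σ[ S ∈ Subset W ] S ∈ C × x ∈ S → x ∈ S′
      above (S , S∈C , x∈S) with tower-comparable (ts S S∈C) t′
      ... | inj₁ S′⊆S = ⊥-elim (none (S , S∈C , S′⊆S))
      ... | inj₂ S⊆S′ = S⊆S′ x∈S

    tower-good : ∀ {S} → Tower S → Good S
    tower-good (step {S} t)   = next-good S (tower-good t)
    tower-good (union C ts) = good-⋃ C
      (λ p q → [ inj₂ , inj₁ ]′ (tower-comparable (ts _ p) (ts _ q)))
      (λ p → tower-good (ts _ p))

    -- The union of the whole tower belongs to the tower, so its successor is contained in it and it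
    -- has no good extension by a new point.
    maximal : Σ[ S ∈ Subset W ] Good S × (∀ y → Good (insert y S) → y ∈ S)
    maximal = top , tower-good top-tower , next-maximal top (∈⋃⁺ {C = ⟪ Tower ⟫} (fromWitness (step top-tower)))
      where
      top : Subset W
      top = ⋃ ⟪ Tower ⟫
      top-tower : Tower top
      top-tower = union ⟪ Tower ⟫ (λ _ → toWitness)

  -- An ultrafilter containing all cones of a directed preorder.

  module _ {i} {I : Set i} (_≤_ : I → I → Set i)
    (≤-refl : ∀ {j} → j ≤ j) (≤-trans : ∀ {j k l} → j ≤ k → k ≤ l → j ≤ l)
    (origin : I) (upper : ∀ j k → Σ[ l ∈ I ] j ≤ l × k ≤ l) where

    Cofinal : List (Subset I) → Set i
    Cofinal As = ∀ j → Σ[ k ∈ I ] j ≤ k × All (k ∈_) As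

    -- Since the order is directed, this says that `U` together with all cones has the finite
    -- intersection property.
    Good : Subset (Subset I) → Set i
    Good U = ∀ As → All (_∈ U) As → Cofinal As

    -- Finitely many sets from the union of a chain lie in a single member of the chain.
    good-⋃ : ∀ C → Chain C → (∀ {U} → U ∈ C → Good U) → Good (⋃ C)
    good-⋃ C chain good As As⊆ with single As As⊆
      where
      single : ∀ As → All (_∈ ⋃ C) As → As ≡ [] ⊎ (Σ[ U ∈ _ ] U ∈ C × All (_∈ U) As)
      -- The empty list is a case of its own because `C` may be empty.
      single []       []       = inj₁ refl
      single (A ∷ As) (p ∷ ps) with ∈⋃⁻ {C = C} {x = A} p | single As ps
      ... | U , U∈C , A∈U | inj₁ refl = inj₂ (U , U∈C , A∈U ∷ [])
      ... | U , U∈C , A∈U | inj₂ (V , V∈C , As⊆V) with chain U∈C V∈C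
      ...   | inj₁ U⊆V = inj₂ (V , V∈C , U⊆V A∈U ∷ As⊆V)
      ...   | inj₂ V⊆U = inj₂ (U , U∈C , A∈U ∷ All.map V⊆U As⊆V)
    ... | inj₁ refl             = λ j → j , ≤-refl , []
    ... | inj₂ (U , U∈C , As⊆U) = good U∈C As As⊆U

    ultrafilter : Ultrafilter I _≤_
    ultrafilter with Maximal.maximal Good good-⋃
    ... | U , good , max = record
      { Large     = Large
      ; mono      = λ {P} {Q} f p → compatible⇒large Q λ As As⊆ j →
          let k , j≤k , k∈ = good (⟪ P ⟫ ∷ As) (lower p ∷ As⊆) j
          in k , j≤k , f k (toWitness (All.head k∈)) , All.tail k∈
      ; _∩_       = λ {P} {Q} p q → compatible⇒large (λ j → P j × Q j) λ As As⊆ j →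
          let k , j≤k , k∈ = good (⟪ P ⟫ ∷ ⟪ Q ⟫ ∷ As) (lower p ∷ lower q ∷ As⊆) j
          in k , j≤k , (toWitness (All.head k∈) , toWitness (All.head (All.tail k∈))) , All.tail (All.tail k∈)
      ; decides   = decides
      ; inhabited = λ {P} p → let j , _ , j∈ = good (⟪ P ⟫ ∷ []) (lower p ∷ []) origin
                              in j , toWitness (All.head j∈)
      ; cone      = λ j → compatible⇒large (j ≤_) λ As As⊆ j′ →
          let l , j≤l , j′≤l = upper j j′
              k , l≤k , k∈   = good As As⊆ l
          in k , ≤-trans j′≤l l≤k , ≤-trans j≤l l≤k , k∈
      }
      where
      Large : (I → Set i) → Set i
      Large P = Lift i (⟪ P ⟫ ∈ U)

      -- Maximality: a set that meets every finite intersection from `U` cofinally can be inserted,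
      -- so it belongs to `U` already.
      compatible⇒large : ∀ P →
        (∀ As → All (_∈ U) As → ∀ j → Σ[ k ∈ I ] j ≤ k × P k × All (k ∈_) As) → Large P
      compatible⇒large P compatible = lift (max ⟪ P ⟫ insert-good)
        where
        insert-good : Good (insert ⟪ P ⟫ U)
        insert-good As As⊆ j =
          let Bs , Bs⊆ , restore   = remaining As As⊆
              k , j≤k , Pk , k∈Bs = compatible Bs Bs⊆ j
          in k , j≤k , restore k Pk k∈Bs
          where
          remaining : ∀ As → All (_∈ insert ⟪ P ⟫ U) As →
            Σ[ Bs ∈ _ ] All (_∈ U) Bs × (∀ k → P k → All (k ∈_) Bs → All (k ∈_) As)
          remaining []       []       = [] , [] , λ _ _ _ → []
          remaining (A ∷ As) (p ∷ ps) with ∈insert⁻ {S = U} {x = A} p | remaining As ps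
          ... | inj₁ A∈U  | Bs , Bs⊆ , f = A ∷ Bs , A∈U ∷ Bs⊆ , λ { k Pk (q ∷ qs) → q ∷ f k Pk qs }
          ... | inj₂ refl | Bs , Bs⊆ , f = Bs , Bs⊆ , λ k Pk qs → fromWitness Pk ∷ f k Pk qs

      -- If `P` is not large, some finite intersection `As` from `U` misses `P` above some `j`.
      -- Beyond `j` it lies in the complement, which is therefore compatible with `U`.
      decides : ∀ {P} → ¬ Large P → Large (λ j → ¬ P j)
      decides {P} ¬large
        with As , ¬As ← ¬∀⇒∃¬ (λ c → ¬large (compatible⇒large P c))
        with As⊆ , ¬As⊆ ← ¬∀⇒∃¬ ¬As
        with j , miss ← ¬∀⇒∃¬ ¬As⊆
        = compatible⇒large (λ k → ¬ P k) λ Bs Bs⊆ j′ →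
          let l , j≤l , j′≤l = upper j j′
              k , l≤k , k∈   = good (As ++ˡ Bs) (All.++⁺ As⊆ Bs⊆) l
              k∈As , k∈Bs    = All.++⁻ As k∈
          in k , ≤-trans j′≤l l≤k , (λ Pk → miss (k , ≤-trans j≤l l≤k , Pk , k∈As)) , k∈Bs

  -- Variables and parameters in an atomic formula.

  -- For x with m parameters and s variables: either x uses no parameter, or it
  -- uses only n < t of the variables.
  FactorsBelow : ∀ {a} {A : ℕ → Set a} → ℕ → (m s : ℕ) →
    (∀ {n n′} → (Fin n → Fin n′) → A n → A n′) → A (m + s) → Set a
  FactorsBelow {A = A} t m s map x =
    (Σ[ y ∈ A s ] x ≡ map (m ↑ʳ_) y) ⊎
    (Σ[ n ∈ ℕ ] n < t × Σ[ h ∈ (Fin n → Fin s) ] (∀ {i j} → h i ≡ h j → i ≡ j) ×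
      Σ[ y ∈ A (m + n) ] x ≡ map (under m h) y)

  -- `entries` becomes the injection `h`, and the strict bound in `size<` is what brings the number
  -- of variables below `t`.
  factor-tuple : ∀ {t r} m s → r ≤ t → (is : Fin r → Fin (m + s)) →
    FactorsBelow {A = λ n → Fin r → Fin n} t m s (λ ρ → ρ ∘_) is
  factor-tuple {t} {r} m s r≤t is = result size<
    where
    open Deduplication (deduplicate (setoid (Fin s)) (λ x w → decide _) (splitAt m ∘ is))
    is≡ : ∀ k → is k ≡ join m s (map₂ entries (indices k))
    is≡ k = trans (sym (join-splitAt m s (is k))) (cong (join m s) (Pointwise-≡⇒≡ (factors k)))
    result : _ → FactorsBelow {A = λ n → Fin r → Fin n} t m s (λ ρ → ρ ∘_) is
    result (inj₁ pure) = inj₁ (entries ∘ proj₁ ∘ pure ,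
      ext λ k → trans (is≡ k) (cong (join m s ∘ map₂ entries) (proj₂ (pure k))))
    result (inj₂ size<r) = inj₂ (size , ≤-trans size<r r≤t , entries , injective , join m size ∘ indices ,
      ext λ k → trans (is≡ k) (cong (join m s ∘ map₂ entries) (sym (splitAt-join m size (indices k)))))

  module _ {L : Language} where
    open Language L

    factor-atomic : ∀ {t} m s → 2 ≤ t → (∀ R → arity R ≤ t) → (α : Atomic L (m + s)) →
      FactorsBelow {A = Atomic L} t m s rename α
    -- An equality is handled as a tuple of length two, which is where `2≤t` enters.
    factor-atomic m s 2≤t arity≤t (i ≐ j) with factor-tuple m s 2≤t (i ∷ᵥ j ∷ᵥ []ᵥ)
    ... | inj₁ (js , eq) = inj₁ (js zero ≐ js (suc zero) ,
            cong (λ is → is zero ≐ is (suc zero)) eq)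
    ... | inj₂ (n , n<t , h , inj , js , eq) = inj₂ (n , n<t , h , inj , (js zero ≐ js (suc zero)) ,
            cong (λ is → is zero ≐ is (suc zero)) eq)
    factor-atomic m s 2≤t arity≤t (rel R is) with factor-tuple m s (arity≤t R) is
    ... | inj₁ (js , eq) = inj₁ (rel R js , cong (rel R) eq)
    ... | inj₂ (n , n<t , h , inj , js , eq) = inj₂ (n , n<t , h , inj , rel R js , cong (rel R) eq)

  -- Ultrapowers and Łoś's theorem.

  module Ultra {i} {I : Set i} {_≤_ : I → I → Set i} (U : Ultrafilter I _≤_) where
    open Ultrafilter U public

    always : ∀ {P : I → Set i} → (∀ j → P j) → Large P
    always p = by-contradiction λ ¬large → let j , ¬Pj = inhabited (decides ¬large) in ¬Pj (p j)

    Large-Fin : ∀ {n} {P : Fin n → I → Set i} → (∀ k → Large (P k)) → Large (λ j → ∀ k → P k j)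
    Large-Fin {zero}  p = always λ j ()
    Large-Fin {suc n} p = mono₂ (λ { j x y zero → x ; j x y (suc k) → y k }) (p zero) (Large-Fin (p ∘ suc))

    Large-Fin→Fin : ∀ {m n} {P : (Fin m → Fin n) → I → Set i} →
      (∀ w → Large (P w)) → Large (λ j → ∀ w → P w j)
    Large-Fin→Fin {P = P} p = mono
      (λ j q w → subst (λ w → P w j) (ext (finToFun-funToFin w)) (q (funToFin w)))
      (Large-Fin (p ∘ finToFun))

    Large-All : {X : Set} {P : X → I → Set i} {xs : List X} →
      All (λ x → Large (P x)) xs → Large (λ j → All (λ x → P x j) xs)
    Large-All []       = always λ j → []
    Large-All (p ∷ ps) = mono₂ (λ j → _∷_) p (Large-All ps)

    Large-→ : ∀ {P Q : I → Set i} → (Large P → Large Q) → Large (λ j → P j → Q j)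
    Large-→ {P} f with decide (Large P)
    ... | yes p = mono (λ j q _ → q) (f p)
    ... | no ¬p = mono (λ j ¬Pj Pj → ⊥-elim (¬Pj Pj)) (decides ¬p)

    Large-const : ∀ {A : Set i} {P : I → Set i} → (A → Large P) → Large (λ j → A → P j)
    Large-const {A} f with decide A
    ... | yes x = mono (λ j p _ → p) (f x)
    ... | no ¬x = always λ j x → ⊥-elim (¬x x)

    module _ {L : Language} (N : Structure L i) where
      private module N = Structure N

      ultrapower : Structure L i
      ultrapower = record
        { domain  = record
          { Carrier       = I → N.Carrier
          ; _≈_           = λ f g → Large λ j → f j N.≈ g j
          ; isEquivalence = record
            { refl  = always λ j → N.refl
            ; sym   = mono λ j → N.sym
            ; trans = mono₂ λ j → N.trans
            }
          }
        ; ⟦_⟧     = λ R v → Large λ j → N.⟦ R ⟧ λ k → v k j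
        ; ⟦⟧-resp = λ R v≈w → mono₂ (λ j → N.⟦⟧-resp R) (Large-Fin v≈w)
        }

      -- Implication uses that the ultrafilter decides each predicate. For the quantifier, failures
      -- on a large set are collected by choice into one element `counter` of the ultrapower.
      łoś : ∀ {n} (φ : Formula L n) {v} → Sat ultrapower φ v ⇔ Large (λ j → Sat N φ (λ k → v k j))
      łoś (atom (x ≐ y))    = mk⇔ id id
      łoś (atom (rel R is)) = mk⇔ id id
      łoś ⊥′      = mk⇔ (λ ()) λ p → proj₂ (inhabited p)
      łoś (φ ⇒ ψ) = mk⇔
        (λ s → Large-→ (Equivalence.to (łoś ψ) ∘ s ∘ Equivalence.from (łoś φ)))
        (λ p s → Equivalence.from (łoś ψ) (mono₂ (λ j f x → f x) p (Equivalence.to (łoś φ) s)))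
      łoś (∀′ φ) {v} = mk⇔
        (λ s → by-contradiction λ ¬large → refute s (decides ¬large))
        (λ p f → Equivalence.from (łoś φ)
          (mono (λ j s → subst (Sat N φ) (sym (at f j)) (s (f j))) p))
        where
        at : ∀ f j → (λ k → (f ∷ᵥ v) k j) ≡ (f j ∷ᵥ λ k → v k j)
        at f j = ext λ { zero → refl ; (suc k) → refl }
        refute : Sat ultrapower (∀′ φ) v → ¬ Large (λ j → ¬ Sat N (∀′ φ) (λ k → v k j))
        refute s p = let j , ¬∀ , sat = inhabited (p ∩ Equivalence.to (łoś φ) (s counter))
          in fails j ¬∀ (subst (Sat N φ) (at counter j) sat)
          where
          -- N is known to be nonempty only because ∀′ φ fails somewhere.
          default : N.Carrier
          default = proj₁ (¬∀⇒∃¬ (proj₂ (inhabited p)))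
          choose : ∀ j → Dec (Σ[ x ∈ N.Carrier ] ¬ Sat N φ (x ∷ᵥ λ k → v k j)) → N.Carrier
          choose j (yes (x , _)) = x
          choose j (no _)        = default
          counter : I → N.Carrier
          counter j = choose j (decide _)
          fails : ∀ j → ¬ Sat N (∀′ φ) (λ k → v k j) → ¬ Sat N φ (counter j ∷ᵥ λ k → v k j)
          fails j ¬∀ with decide (Σ[ x ∈ N.Carrier ] ¬ Sat N φ (x ∷ᵥ λ k → v k j))
          ... | yes (_ , ¬φ) = ¬φ
          ... | no  none     = λ _ → none (¬∀⇒∃¬ ¬∀)

    -- Each map `x ↦ ι (σ.to j x)` is elementary, so a formula true of `v` in `M` holds at every
    -- index and a false one at none. Łoś's theorem does the rest.
    ultrapowerExtension : {L : Language} {M : Structure L i} →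
      ElementaryExtension M → (I → Automorphism M) → ElementaryExtension M
    ultrapowerExtension {M = M} E σ = record
      { extension = ultrapower extension
      ; embedding = record
        { injection = record
          { to        = λ x j → ι (σ.to j x)
          ; cong      = λ x≈y → always λ j → ι.cong (σ.cong j x≈y)
          ; injective = λ p → let j , q = inhabited p in σ.injective j (ι.injective q)
          }
        ; relations = λ R v → elementary′ (atom (rel R id)) v
        }
      ; elementary = λ φ v → ⇔-sym (łoś extension φ) ⇔-∘ elementary′ φ v
      }
      where
      open ElementaryExtension E
      module ι = Embedding embedding
      module σ j = Isomorphism (σ j)
      elementary′ : ∀ {n} (φ : Formula _ n) (v : Vector (Structure.Carrier M) n) →
        Sat M φ v ⇔ Large (λ j → Sat extension φ (λ k → ι (σ.to j (v k))))
      elementary′ φ v = mk⇔ (λ s → always λ j → Equivalence.to (factor j) s)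
        (λ p → let j , s = inhabited p in Equivalence.from (factor j) s)
        where
        factor : ∀ j → Sat M φ v ⇔ Sat extension φ (λ k → ι (σ.to j (v k)))
        factor j = elementary φ (σ.to j ∘ v) ⇔-∘ Sat-iso (σ j) φ (λ k → Structure.refl M)

  -- Homogeneous copies for a single atom.

  module _ {L : Language} {ℓ : Level} {M : Structure L ℓ} (a : EnumeratedAge M) where
    open Language L
    open EnumeratedAge a
    open Structure M using (Carrier; _≈_)
    private module M = Structure M

    module _ {t : ℕ} (2≤t : 2 ≤ t) (arity≤t : ∀ R → arity R ≤ t)
      (ramsey : (b : EnumeratedAge M) → EnumeratedAge.size b < t →
        RamseyProperty b (ExternallyAtomicDefinable b))
      (E : ElementaryExtension M) where
      open ElementaryExtension E

      homogeneous-atom : ∀ {m} (e : Vector (Structure.Carrier extension) m) (α : Atomic L (m + size)) →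
        HomogeneousCopies a E e (α ∷ [])
      homogeneous-atom {m} e α {B} B∈Age with factor-atomic m size 2≤t arity≤t α
      -- No parameter occurs, so any copy of `B` serves; the given embedding supplies one.
      ... | inj₁ (β , refl) = image (proj₂ B∈Age) , image-iso (proj₂ B∈Age) ⁻¹ , homogeneous ∷ []
        where
        pure : ∀ {c} → IsCopy a M c → SatAtomic structure β tuple ⇔ SatCopy a E e (rename (m ↑ʳ_) β) c
        pure {c} (f , c≈f) = ⇔-sym (Sat-rename (m ↑ʳ_) β) ⇔-∘
          SatAtomic-embedding (embedding ∘ₑ f) β λ k → N.trans
            (Embedding.cong embedding (M.sym (c≈f k)))
            (N.reflexive (sym (lookup-++ʳ e (ι ∘ c) k)))
          where module N = Structure extension
        homogeneous : Homogeneous a E e (rename (m ↑ʳ_) β) (Substructure.Member (image (proj₂ B∈Age)))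
        homogeneous c d _ _ = Equivalence.to (pure d) ∘ Equivalence.from (pure c)
      ... | inj₂ (n , n<t , h , h-injective , β , refl)
        with ramsey (subtuple a h h-injective) n<t B B∈Age χ (E , m , e , β , λ c → colour≡zero (decide _))
        where
        χ : Colouring (subtuple a h h-injective) 2
        χ = record
          { to   = λ c → colour (decide (SatCopy (subtuple a h h-injective) E e β (proj₁ c)))
          ; cong = λ {c} {d} c≈d → colour-cong
              (SatCopy-resp (subtuple a h h-injective) E e β c≈d)
              (SatCopy-resp (subtuple a h h-injective) E e β {proj₁ d} {proj₁ c} (λ k → M.sym (c≈d k)))
              (decide _) (decide _)
          }
      ... | S , S≅B , constant = S , S≅B , homogeneous ∷ []
        where
        open Substructure S
        b = subtuple a h h-injective
        shrink : ∀ {c} → SatCopy a E e (rename (under m h) β) c ⇔ SatCopy b E e β (c ∘ h)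
        shrink {c} = mk⇔
          (SatAtomic-resp extension β (N.reflexive ∘ ++-under e (ι ∘ c) h))
          (SatAtomic-resp extension β (N.sym ∘ N.reflexive ∘ ++-under e (ι ∘ c) h))
          ⇔-∘ Sat-rename (under m h) β
          where module N = Structure extension
        homogeneous : Homogeneous a E e (rename (under m h) β) Member
        homogeneous {c} {d} c-copy d-copy c∈S d∈S s =
          Equivalence.from shrink (Equivalence.to (colour≡zero (decide _))
            (trans (constant (sub d-copy d∈S) (sub c-copy c∈S))
              (Equivalence.from (colour≡zero (decide _)) (Equivalence.to (shrink {c}) s))))
          where
          -- A copy of the whole tuple inside `S` restricts along `h` to a copy of the subtuple
          -- inside `S`, where `χ` is constant.
          sub : ∀ {c} → IsCopy a M c → (∀ k → Member (c k)) → Copy b (induced S)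
          sub c-copy c∈S = restrictCopy b S (_ , IsCopy-subtuple a h h-injective c-copy) (c∈S ∘ h)

    -- Moving finite tuples into homogeneous sets.

    Index : Set ℓ
    Index = Σ[ n ∈ ℕ ] Vector Carrier n

    _⊑_ : Index → Index → Set ℓ
    (m , v) ⊑ (n , w) = ∀ k → Σ[ j ∈ Fin n ] v k ≡ w j

    ⊑-ultrafilter : Ultrafilter Index _⊑_
    ⊑-ultrafilter = ultrafilter _⊑_ (λ k → k , refl)
      (λ p q k → let j , eq = p k ; l , eq′ = q j in l , trans eq eq′)
      (0 , λ ())
      (λ (m , v) (n , w) → (m + n , v ++ w) ,
        (λ k → k ↑ˡ n , sym (lookup-++ˡ v w k)) ,
        (λ k → m ↑ʳ k , sym (lookup-++ʳ v w k)))

    homogenise : Ultrahomogeneous M → (E : ElementaryExtension M) →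
      ∀ {m} (e : Vector (Structure.Carrier (ElementaryExtension.extension E)) m) α →
      HomogeneousCopies a E e (α ∷ []) → ((n , v) : Index) →
      Σ[ σ ∈ Automorphism M ] Homogeneous a E e α (λ x → ∃ λ k → Isomorphism.to σ (v k) ≈ x)
    homogenise ultrahomogeneous E e α homogeneous (n , v) =
      σ , λ c-copy d-copy c∈ d∈ → S-homogeneous c-copy d-copy (in-S ∘ c∈) (in-S ∘ d∈)
      where
      -- Enumerations admit no repetition, so the substructure is spanned by the distinct entries of
      -- `v`.
      open Deduplication (deduplicate M.domain {Z = ⊥} (λ x w → decide _) (inj₂ ∘ v)) renaming (size to r)
      B = spanned M entries injective
      f = spanned-embedding M entries injective
      B-finite : Finite B
      B-finite = r , spanned-enumeration M entries injective
      S-homogeneous-copy = homogeneous (B-finite , f)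
      S = proj₁ S-homogeneous-copy
      S≅B = proj₁ (proj₂ S-homogeneous-copy)
      S-homogeneous = All.head (proj₂ (proj₂ S-homogeneous-copy))
      open Substructure S
      g : Isomorphism (induced (image f)) (induced S)
      g = S≅B ⁻¹ ∘ᵢ image-iso f ⁻¹
      extended = ultrahomogeneous (image f) S
        (Finite-iso (image-iso f) B-finite) (Finite-iso (S≅B ⁻¹) B-finite) g
      σ = proj₁ extended
      v∈T : ∀ k → Substructure.Member (image f) (v k)
      v∈T k = range (indices k) (factors k)
        where
        range : ∀ u → Pointwise _≡_ _≈_ (inj₂ (v k)) (map₂ entries u) → Substructure.Member (image f) (v k)
        range (inj₂ j) (inj₂ v≈) = lift j , M.sym v≈
      in-S : ∀ {x} → (∃ λ k → Isomorphism.to σ (v k) ≈ x) → Member x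
      in-S (k , σv≈x) = Member-resp (M.trans (M.sym (proj₂ extended (v k , v∈T k))) σv≈x)
        (proj₂ (Isomorphism.to g (v k , v∈T k)))

    -- Transfer between an extension and its ultrapower.

    module Transfer (U : Ultrafilter Index _⊑_) (E : ElementaryExtension M) (σ : Index → Automorphism M) where
      open Ultra U
      open ElementaryExtension E
      private
        module N = Structure extension
        module σ i = Isomorphism (σ i)

      E* : ElementaryExtension M
      E* = ultrapowerExtension E σ

      module _ {m : ℕ} (e : Vector N.Carrier m) where

        e* : Vector (Index → N.Carrier) m
        e* k _ = e k

        limit : ∀ β {c} → SatCopy a E* e* β c ⇔ Large (λ i → SatCopy a E e β (σ.to i ∘ c))
        limit β {c} = mk⇔
          (mono λ i → SatAtomic-resp extension β (N.reflexive ∘ at i))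
          (mono λ i → SatAtomic-resp extension β (N.sym ∘ N.reflexive ∘ at i))
          ⇔-∘ łoś extension (atom β)
          where
          at : ∀ i k → (e* ++ (λ k i → ι (σ.to i (c k)))) k i ≡ (e ++ (ι ∘ σ.to i ∘ c)) k
          at i k with splitAt m k
          ... | inj₁ _ = refl
          ... | inj₂ _ = refl

        -- From the index `c ++ d` upwards, both copies have their entries in the tuple that `σ i`
        -- moves into a homogeneous set. This cone is large, so the atom passes from `c` to `d` in
        -- the limit, whatever `P` is.
        homogeneous-limit : ∀ {P : Carrier → Set ℓ} α →
          (∀ i → Homogeneous a E e α (λ x → ∃ λ k → σ.to i (proj₂ i k) ≈ x)) →
          Homogeneous a E* e* α P
        homogeneous-limit α homogeneous {c} {d} c-copy d-copy _ _ s = Equivalence.from (limit α) (mono₂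
          (λ i cd⊑i → homogeneous i
            (IsCopy-∘ a (isoEmbedding (σ i)) c-copy) (IsCopy-∘ a (isoEmbedding (σ i)) d-copy)
            (λ k → entry i (trans (sym (lookup-++ˡ c d k)) (proj₂ (cd⊑i (k ↑ˡ size)))))
            (λ k → entry i (trans (sym (lookup-++ʳ c d k)) (proj₂ (cd⊑i (size ↑ʳ k))))))
          (cone (size + size , c ++ d)) (Equivalence.to (limit α) s))
          where
          entry : ∀ i {j} {x} → x ≡ proj₂ i j → ∃ λ k → σ.to i (proj₂ i k) ≈ σ.to i x
          entry i {j} refl = j , M.refl

        module _ {αs : List (Atomic L (m + size))} {B : Structure L ℓ} (B∈Age : B ∈Age M)
          (S : Substructure M) (S≅B : Isomorphism (induced S) B)
          (homogeneous* : All (λ α → Homogeneous a E* e* α (Substructure.Member S)) αs) where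
          open Substructure S

          S-finite : Finite (induced S)
          S-finite = Finite-iso (S≅B ⁻¹) (proj₁ B∈Age)
          module S-enumeration = Bijection (proj₂ S-finite)

          -- Tuples in `S` are coded, up to `≈`, by maps between finite sets; this leaves only
          -- finitely many pairs to compare in `Good-at`.
          from-S : (Fin size → Fin (proj₁ S-finite)) → Vector Carrier size
          from-S w = proj₁ ∘ S-enumeration.to ∘ w

          Good-at : Index → Atomic L (m + size) → Set ℓ
          Good-at i β = ∀ w w′ → IsCopy a M (from-S w) → IsCopy a M (from-S w′) →
            SatCopy a E e β (σ.to i ∘ from-S w) → SatCopy a E e β (σ.to i ∘ from-S w′)

          -- Each single condition is large by `limit`, and there are finitely many codes and atoms.
          -- Being a copy does not involve the index, hence `Large-const`.
          good-large : Large (λ i → All (Good-at i) αs)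
          good-large = Large-All (All.map (λ {β} → large β) homogeneous*)
            where
            large : ∀ β → Homogeneous a E* e* β Member → Large (λ i → Good-at i β)
            large β homogeneous = Large-Fin→Fin λ w → Large-Fin→Fin λ w′ →
              Large-const λ w-copy → Large-const λ w′-copy →
              Large-→ (Equivalence.to (limit β)
                ∘ homogeneous w-copy w′-copy (proj₂ ∘ S-enumeration.to ∘ w) (proj₂ ∘ S-enumeration.to ∘ w′)
                ∘ Equivalence.from (limit β))

          i : Index
          i = proj₁ (inhabited good-large)
          good : All (Good-at i) αs
          good = proj₂ (inhabited good-large)

          module _ (c : Vector Carrier size) (c∈ : ∀ k → Member (from (σ i) (c k))) where

            index : Fin size → Fin (proj₁ S-finite)
            index k = S-enumeration.to⁻ (from (σ i) (c k) , c∈ k)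

            from-S-index : ∀ k → from-S index k ≈ from (σ i) (c k)
            from-S-index k = proj₂ (S-enumeration.strictlySurjective (from (σ i) (c k) , c∈ k))

            σ-from-S-index : ∀ k → σ.to i (from-S index k) ≈ c k
            σ-from-S-index k = M.trans (σ.cong i (from-S-index k)) (to-from (σ i) (c k))

            IsCopy-index : IsCopy a M c → IsCopy a M (from-S index)
            IsCopy-index c-copy = let f , c≈f = IsCopy-∘ a (isoEmbedding (σ i ⁻¹)) c-copy
              in f , λ k → M.trans (from-S-index k) (c≈f k)

          -- Copies in the image of `S` under `σ i` are pulled back to `S` and replaced by coded
          -- tuples, where `Good-at` applies. The replacement is exact only up to `≈`, which
          -- `SatCopy-resp` absorbs.
          translate : ∀ β → Good-at i β → Homogeneous a E e β (Member ∘ from (σ i))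
          translate β good-at {c} {d} c-copy d-copy c∈ d∈ =
            SatCopy-resp a E e β (σ-from-S-index d d∈) ∘
            good-at (index c c∈) (index d d∈) (IsCopy-index c c∈ c-copy) (IsCopy-index d d∈ d-copy) ∘
            SatCopy-resp a E e β (λ k → M.sym (σ-from-S-index c c∈ k))

          copy-below : Σ[ S′ ∈ Substructure M ] Isomorphism (induced S′) B ×
            All (λ α → Homogeneous a E e α (Substructure.Member S′)) αs
          -- This is the image of `S` under `σ i`, written as a preimage under the inverse.
          copy-below = preimage (σ i ⁻¹) S , S≅B ∘ᵢ preimage-iso (σ i ⁻¹) S ,
            All.map (λ {β} → translate β) good

        homogeneous-descent : ∀ {αs} → HomogeneousCopies a E* e* αs → HomogeneousCopies a E e αs
        homogeneous-descent copies B∈Age = let S , S≅B , homogeneous* = copies B∈Age in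
          copy-below B∈Age S S≅B homogeneous*

    -- Induction on the list. Each step replaces the extension by an ultrapower, so `E` and `e` are
    -- quantified after `αs`, and `atomic` is assumed for every extension.
    homogeneous-copies : Ultrafilter Index _⊑_ → Ultrahomogeneous M →
      (∀ E {m} (e : Vector (Structure.Carrier (ElementaryExtension.extension E)) m) α →
        HomogeneousCopies a E e (α ∷ [])) →
      ∀ {m} (αs : List (Atomic L (m + size))) E e → HomogeneousCopies a E e αs
    homogeneous-copies U ultrahomogeneous atomic [] E e (_ , f) = image f , image-iso f ⁻¹ , []
    homogeneous-copies U ultrahomogeneous atomic (α ∷ αs) E e =
      homogeneous-descent e λ B∈Age →
        let S , S≅B , homogeneous = homogeneous-copies U ultrahomogeneous atomic αs E* (e* e) B∈Age
        -- In `E*` the first atom is homogeneous on all of `M`, hence on whatever `S` the remaining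
        -- atoms give.
        in S , S≅B , homogeneous-limit e {Substructure.Member S} α (proj₂ ∘ homogenised) ∷ homogeneous
      where
      homogenised = homogenise ultrahomogeneous E e α (atomic E e α)
      open Transfer U E (proj₁ ∘ homogenised)

  -- Quantifier elimination and the conclusion.

  Th-elementary : ∀ {L : Language} {ℓ} {M : Structure L ℓ} (E : ElementaryExtension M) →
    ElementaryExtension.extension E ⊨ Th M
  Th-elementary E σ s = subst (Sat extension σ) (ext λ ()) (Equivalence.to (elementary σ []ᵥ) s)
    where open ElementaryExtension E

  externally-definable-ramsey : ∀ {ℓ} (L : Language) (t : ℕ) → 2 ≤ t → MaximumArity L t →
    (M : Structure L ℓ) → Ultrahomogeneous M →
    HasQuantifierElimination (Th M) →
    ((a : EnumeratedAge M) → EnumeratedAge.size a < t →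
      RamseyProperty a (ExternallyAtomicDefinable a)) →
    ExternallyDefinableRamsey M
  externally-definable-ramsey L t 2≤t (arity≤t , _) M ultrahomogeneous qe ramsey
      a k _ B B∈Age χ (E , m , e , φ , χ⇔φ)
    with homogeneous-copies a (⊑-ultrafilter a) ultrahomogeneous (homogeneous-atom a 2≤t arity≤t ramsey)
           -- The atoms for all `k` colours are made homogeneous at once.
           (concat (tabulate λ i → atoms (proj₁ (proj₂ (qe (φ i)))))) E e B∈Age
  ... | S , S≅B , homogeneous = S , S≅B , constant
    where
    open ElementaryExtension E
    qf : ∀ i → QuantifierFree (proj₁ (qe (φ i)))
    qf i = proj₁ (proj₂ (qe (φ i)))
    φ⇔ψ : ∀ i v → Sat extension (φ i) v ⇔ Sat extension (proj₁ (qe (φ i))) v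
    φ⇔ψ i = proj₂ (proj₂ (qe (φ i))) extension (Th-elementary E)
    constant : ConstantOn a χ S
    constant c d = sym (Equivalence.from (χ⇔φ (includeCopy a S d) i)
      (Equivalence.from (φ⇔ψ i _) (Equivalence.to (Sat-atoms (qf i) same)
        (Equivalence.to (φ⇔ψ i _) (Equivalence.to (χ⇔φ (includeCopy a S c) i) refl)))))
      where
      -- It is enough to carry over the formula for the colour of `c`: once it holds at `d`, the
      -- colour of `d` is `i` too.
      i = Func.to χ (includeCopy a S c)
      swap : ∀ {α} → Homogeneous a E e α (Substructure.Member S) →
        SatCopy a E e α (proj₁ ∘ proj₁ c) ⇔ SatCopy a E e α (proj₁ ∘ proj₁ d)
      swap h = mk⇔
        (h (proj₂ (includeCopy a S c)) (proj₂ (includeCopy a S d)) (proj₂ ∘ proj₁ c) (proj₂ ∘ proj₁ d))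
        (h (proj₂ (includeCopy a S d)) (proj₂ (includeCopy a S c)) (proj₂ ∘ proj₁ d) (proj₂ ∘ proj₁ c))
      same : All _ (atoms (qf i))
      same = All.map (λ {α} → swap {α}) (All.tabulate⁻ (All.concat⁻ homogeneous) i)

proposition3p13 : (∀ {a} → ExcludedMiddle a) →
    (∀ {a b} → Extensionality a b) →
    ∀ {ℓ} (L : Language) → Countable L →
    (t : ℕ) → 2 ≤ t → MaximumArity L t →
    (M : Structure L ℓ) → Ultrahomogeneous M →
    HasQuantifierElimination (Th M) →
    ((a : EnumeratedAge M) → EnumeratedAge.size a < t →
    RamseyProperty a (ExternallyAtomicDefinable a)) →
    ExternallyDefinableRamsey M
proposition3p13 em ext L _ = Classical.externally-definable-ramsey em ext L
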